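{- Let $H$ be a graph. Every $H$-graph has mim-width at most $\max\{1,2\|H\|\}$.
   Context: All graphs are finite, undirected, loopless, and may have multiple edges. $\|H\|$ denotes the number of edges of $H$ (counted with multiplicity). For $X\subseteq V(G)$, $\overline{X}=V(G)\setminus X$, and for disjoint $X,Y\subseteq V(G)$, $G[X,Y]$ is the bipartite subgraph of $G$ with vertex set $X\cup Y$ whose edges are the edges of $G$ with one endpoint in $X$ and the other in $Y$. Let $H$ be a (multi)graph. A graph $G$ is an $H$-graph if there are a subdivision $H'$ of $H$ and a collection $\mathcal{M}=\{M_v\}_{v\in V(G)}$ of non-empty subsets of $V(H')$, each inducing a connected subgraph of $H'$, such that $G$ is (isomorphic to) the intersection graph of $\mathcal{M}$. A branch decomposition of $G$ is a pair $(T,\delta)$ where $T$ is a full binary rooted tree (that is, every non-leaf vertex has degree 3) and $\delta$ is a bijection from the leaves of $T$ to $V(G)$. For $w\in V(T)$, $V_w$ is the set of vertices of $G$ in bijection with the leaves of the subtree of $T$ rooted at $w$. An induced matching of a graph is a set of vertices inducing a disjoint union of edges. $\operatorname{mim}(X)$, for $X\subseteq V(G)$, is the maximum number of edges in an induced matching of $G[X,\overline{X}]$. The mim-width of $(T,\delta)$ is the maximum of $\operatorname{mim}(V_w)$ over all $w\in V(T)$; the mim-width of $G$ is the minimum mim-width of a branch decomposition of $G$. -}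

module Defs where

open import Data.Bool.Base using (_∧_; _∨_)
open import Data.Fin.Base using (Fin; zero; suc; inject₁)
open import Data.Fin.Subset as Subset using (Subset; ⁅_⁆; ⋃; ∁; _∩_; ∣_∣)
import Data.List.Base as List
open import Data.Nat.Base using (ℕ; zero; suc; _≤_)
open import Data.Product using (Σ-syntax; ∃-syntax; ∃!; _×_; _,_; proj₁; proj₂)
open import Data.Sum.Base using (_⊎_; inj₁; inj₂)
open import Data.Sum.Properties using (inj₁-injective)
open import Data.Tree.Binary using (Tree; leaf; node; module Leaves)
open import Data.Unit.Base using (⊤)
open import Data.Vec.Base using (Vec; _∷_; _∷ʳ_; lookup; tabulate)
open import Function.Base using (_∘_)
open import Function.Bundles using (_⇔_)
open import Function.Definitions using (Bijective)
open import Level using (0ℓ)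
open import Relation.Binary.Construct.Closure.ReflexiveTransitive using (Star)
open import Relation.Binary.PropositionalEquality using (_≡_; _≢_; refl)
open import Relation.Unary using (Pred; Decidable; Satisfiable; _≬_; _∈_)

-- Undirected: the order of the two ends of an edge carries no meaning, and
-- the notions below do not depend on it.
record Multigraph (V E : Set) : Set where
  field
    ends     : E → V × V
    loopless : ∀ e → proj₁ (ends e) ≢ proj₂ (ends e)

  Joins : E → V → V → Set
  Joins e u v = ends e ≡ (u , v) ⊎ ends e ≡ (v , u)

  Adjacent : V → V → Set
  Adjacent u v = ∃[ e ] Joins e u v

  Incident : V → E → Set
  Incident v e = v ≡ proj₁ (ends e) ⊎ v ≡ proj₂ (ends e)

  InducesConnected : Pred V 0ℓ → Set
  InducesConnected P =
    ∀ {u v} → u ∈ P → v ∈ P → Star (λ x y → Adjacent x y × x ∈ P × y ∈ P) u v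

  IsSimple : Set
  IsSimple = ∀ {e f u v} → Joins e u v → Joins f u v → e ≡ f

Graph : ℕ → ℕ → Set
Graph n m = Multigraph (Fin n) (Fin m)

‖_‖ : ∀ {n m} → Graph n m → ℕ
‖_‖ {m = m} _ = m

module _ {n m} (H : Graph n m) (ℓ : Fin m → ℕ) where
  open Multigraph H

  SubdivVertex : Set
  SubdivVertex = Fin n ⊎ Σ[ e ∈ Fin m ] Fin (ℓ e)

  SubdivEdge : Set
  SubdivEdge = Σ[ e ∈ Fin m ] Fin (suc (ℓ e))

  -- The path with ℓ e inner vertices that replaces the edge e; its i-th edge
  -- joins its i-th and (i + 1)-st vertices.
  path : (e : Fin m) → Vec SubdivVertex (suc (suc (ℓ e)))
  path e = inj₁ (proj₁ (ends e))
         ∷ (tabulate (λ i → inj₂ (e , i)) ∷ʳ inj₁ (proj₂ (ends e)))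

  private
    consecutive-distinct :
      ∀ {A : Set} {k} {x y : A} {f : Fin k → A} →
      x ≢ y → (∀ i → x ≢ f i) → (∀ i → f i ≢ y) → (∀ {i j} → f i ≡ f j → i ≡ j) →
      ∀ i → lookup (x ∷ (tabulate f ∷ʳ y)) (inject₁ i) ≢ lookup (tabulate f ∷ʳ y) i
    consecutive-distinct {k = zero}  x≢y x≢f f≢y inj zero = x≢y
    consecutive-distinct {k = suc k} x≢y x≢f f≢y inj zero = x≢f zero
    consecutive-distinct {k = suc k} x≢y x≢f f≢y inj (suc i) =
      consecutive-distinct (f≢y zero) (λ j eq → 0≢suc (inj eq)) (f≢y ∘ suc)
        (λ eq → suc-inj (inj eq)) i
      where
      0≢suc : ∀ {j : Fin k} → Fin.zero ≢ suc j
      0≢suc ()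
      suc-inj : ∀ {i j : Fin k} → Fin.suc i ≡ suc j → i ≡ j
      suc-inj refl = refl

  subdivide : Multigraph SubdivVertex SubdivEdge
  subdivide = record
    { ends     = λ (e , i) → lookup (path e) (inject₁ i) , lookup (path e) (suc i)
    ; loopless = λ (e , i) → consecutive-distinct
        (loopless e ∘ inj₁-injective) (λ _ ()) (λ _ ()) (λ { refl → refl }) i
    }

-- The collection is indexed by V(G) itself, so the isomorphism from G to the
-- intersection graph is v ↦ M v.
record IsIntersectionGraph {n m} {A : Set} (G : Graph n m) (M : Fin n → Pred A 0ℓ) : Set where
  open Multigraph G
  field
    simple   : IsSimple
    adjacent : ∀ u v → Adjacent u v ⇔ (u ≢ v × M u ≬ M v)

record _IsGraphOver_ {p q n m} (G : Graph p q) (H : Graph n m) : Set₁ where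
  field
    ℓ : Fin m → ℕ
    M : Fin p → Pred (SubdivVertex H ℓ) 0ℓ
    -- Classically automatic: the subsets of a finite set are the decidable ones.
    M?           : ∀ v → Decidable (M v)
    nonEmpty     : ∀ v → Satisfiable (M v)
    connected    : ∀ v → Multigraph.InducesConnected (subdivide H ℓ) (M v)
    intersection : IsIntersectionGraph G M

IsMaximum : Pred ℕ 0ℓ → ℕ → Set
IsMaximum P k = P k × (∀ {j} → P j → j ≤ k)

IsMinimum : Pred ℕ 0ℓ → ℕ → Set
IsMinimum P k = P k × (∀ {j} → P j → k ≤ j)

module _ {n m} (G : Graph n m) where
  open Multigraph G

  -- Spanning subgraphs of G are represented by their edge sets.  This is
  -- G[X,Y] when X and Y partition V(G).
  between : Subset n → Subset n → Subset m
  between X Y = tabulate λ e → let (u , v) = ends e in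
    (lookup X u ∧ lookup Y v) ∨ (lookup Y u ∧ lookup X v)

  inside : Subset m → Subset n → Subset m
  inside F S = F ∩ tabulate λ e → let (u , v) = ends e in lookup S u ∧ lookup S v

  -- S induces a disjoint union of edges in the subgraph with edge set F: the
  -- edges of the induced subgraph partition S.
  IsInducedMatching : Subset m → Subset n → Set
  IsInducedMatching F S =
    ∀ {v} → v Subset.∈ S → ∃! _≡_ λ e → e Subset.∈ inside F S × Incident v e

  IsMim : Subset n → ℕ → Set
  IsMim X = IsMaximum λ k →
    ∃[ S ] IsInducedMatching (between X (∁ X)) S × ∣ inside (between X (∁ X)) S ∣ ≡ k

data Node {N L : Set} : Tree N L → Set where
  here  : ∀ {t} → Node t
  left  : ∀ {l x r} → Node l → Node (node l x r)
  right : ∀ {l x r} → Node r → Node (node l x r)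

subtree : ∀ {N L} {t : Tree N L} → Node t → Tree N L
subtree {t = t} here = t
subtree (left w)     = subtree w
subtree (right w)    = subtree w

-- Each leaf x of the tree is labelled by the vertex δ(x); the leaves are
-- identified with their positions in the left-to-right list of leaf labels.
record BranchDecomposition (n : ℕ) : Set where
  field
    tree      : Tree ⊤ (Fin n)
    bijective : Bijective _≡_ _≡_ (List.lookup (Leaves.toList tree))

  verticesBelow : Node tree → Subset n
  verticesBelow w = ⋃ (List.map ⁅_⁆ (Leaves.toList (subtree w)))

module _ {n m} (G : Graph n m) where

  IsWidth : BranchDecomposition n → ℕ → Set
  IsWidth D = IsMaximum λ k → ∃[ w ] IsMim G (verticesBelow w) k
    where open BranchDecomposition D

  IsMimWidth : ℕ → Set
  IsMimWidth = IsMinimum λ k → ∃[ D ] IsWidth D k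

{-# OPTIONS --safe #-}

-- Number the positions on the subdivided edges of H lexicographically (edge by
-- edge, along each edge), and order V(G) by the first position in each M v, the
-- vertices whose M v is an isolated vertex of H coming last.  In the caterpillar
-- with this leaf order every cut is either {y} against the rest, with mim at
-- most 1, or "early" against "late": there is a threshold start e on each edge e
-- such that M y of every late y has no position on e before start e, while M x of
-- every early x contains some position not after its threshold.  For a matching
-- edge xy, walk inside M x from such a position to a point z of M y: the last
-- edge e of H on the walk is traversed in one of two directions, and M x contains
-- all of e from where it is entered (or from start e) to z.  The pair of e and the
-- direction determines xy: of two matching edges with the same pair, the longer
-- stretch contains the end of the shorter one, so the matching is not induced.
-- Hence there are at most 2‖H‖ edges.  Cuts within the isolated part give at most 1.

module Submission where

open import Defs
open import Data.Bool.Base using (true; false; _∧_; _∨_)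
open import Data.Bool.Properties using (∨-zeroʳ)
open import Data.Fin.Base using (Fin; zero; suc; toℕ; inject₁; fromℕ; fromℕ<; combine)
open import Data.Fin.Properties as Fin
  using (any?; all?; injective⇒≤; suc-injective; toℕ-inject₁; toℕ-injective; toℕ<n; ≤fromℕ;
         combine-injective)
open import Data.Fin.Relation.Unary.Top using (view; ‵fromℕ; ‵inject₁)
open import Data.Fin.Subset using (Subset; ∣_∣; ⊥; ⁅_⁆; ⋃; ∁; _∈_; _∉_)
open import Data.Fin.Subset.Properties
  using (_∈?_; anySubset?; ∣p∣≤n; ∉⊥; x∈p∩q⁻; x∈p∩q⁺; x∈∁p⇒x∉p; x∉p⇒x∈∁p;
         x∈⁅x⁆; x∈⁅y⁆⇒x≡y; x∈p∪q⁻; x∈p∪q⁺)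
open import Data.List.Base as List
  using (List; []; _∷_; _++_; allFin; cartesianProductWith; filter; length)
open import Data.List.Membership.Propositional using () renaming (_∈_ to _∈ˡ_)
open import Data.List.Membership.Propositional.Properties
  using (∈-++⁺ˡ; ∈-++⁺ʳ; ∈-map⁺; ∈-allFin; ∈-cartesianProductWith⁺; ∈-filter⁺; ∈-lookup)
open import Data.List.Relation.Binary.Permutation.Propositional using (↭-sym; ↭⇒↭ₛ)
open import Data.List.Relation.Binary.Permutation.Propositional.Properties using (∈-resp-↭)
import Data.List.Relation.Binary.Permutation.Setoid.Properties as Permutation
open import Data.List.Relation.Unary.All as All using (All; []; _∷_)
open import Data.List.Relation.Unary.All.Properties using (all-filter)
open import Data.List.Relation.Unary.AllPairs using (AllPairs; []; _∷_)
open import Data.List.Relation.Unary.Any as Any using (here; there)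
open import Data.List.Relation.Unary.Any.Properties using (lookup-index)
open import Data.List.Relation.Unary.Sorted.TotalOrder.Properties using (Sorted⇒AllPairs)
open import Data.List.Relation.Unary.Unique.Propositional using (Unique)
open import Data.List.Relation.Unary.Unique.Propositional.Properties using (allFin⁺)
import Data.List.Sort
open import Data.Nat.Base
  using (ℕ; zero; suc; NonZero; _≤_; _<_; _*_; _⊔_; _+_; s≤s; z≤n; >-nonZero⁻¹)
import Data.Nat.Properties as ℕ
open import Data.List.Extrema ℕ.≤-totalOrder
  using (argmin; argmin-all; f[argmin]≤f[⊤]; f[argmin]≤f[xs]; argmax; f[xs]≤f[argmax])
open import Data.Product using (Σ; ∃; ∃₂; ∃-syntax; ∃!; _×_; _,_; proj₁; proj₂)
open import Data.Product.Relation.Binary.Lex.NonStrict using (×-decTotalOrder)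
open import Data.Sum.Base using (_⊎_; inj₁; inj₂; [_,_]′; swap)
open import Data.Tree.Binary using (Tree; leaf; node; #leaves; module Leaves)
open import Data.Unit.Base using (⊤; tt)
open import Data.Vec.Base using (Vec; []; _∷_; _∷ʳ_; lookup; tabulate; here; there)
open import Data.Vec.Properties using (lookup∘tabulate; []=⇒lookup; lookup⇒[]=)
open import Function.Base using (_∘_; _$_; _∋_; id)
open import Function.Bundles using (Equivalence)
open import Function.Definitions using (Injective; Bijective)
open import Level using (0ℓ)
open import Relation.Binary.Bundles using (DecTotalOrder)
open import Relation.Binary.Construct.Closure.ReflexiveTransitive using (Star; ε; _◅_)
import Relation.Binary.Construct.On as On
open import Relation.Binary.Definitions using (Reflexive; tri<; tri≈; tri>)
open import Relation.Binary.PropositionalEquality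
open import Relation.Nullary using (Dec; yes; no; ¬_; contradiction; _×-dec_; _→-dec_; _⊎-dec_)
open import Relation.Nullary.Decidable using (map′)
open import Relation.Unary using (Pred; Decidable; _≬_) renaming (_∈_ to _∈ᴾ_; _∉_ to _∉ᴾ_)

-- Bounded maxima, counting by labels, and decidability.

maximum : ∀ {P : Pred ℕ 0ℓ} → Decidable P → ∃ P → ∀ b → (∀ {k} → P k → k ≤ b) → ∃ (IsMaximum P)
maximum {P} P? (k , Pk) zero bounded = zero , subst P (ℕ.n≤0⇒n≡0 (bounded Pk)) Pk , bounded
maximum P? ∃P (suc b) bounded with P? (suc b)
... | yes Pb = suc b , Pb , bounded
... | no ¬Pb = maximum P? ∃P b
  λ Pk → ℕ.≤-pred (ℕ.≤∧≢⇒< (bounded Pk) λ { refl → ¬Pb Pk })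

IsMaximum-unique : ∀ {P j k} → IsMaximum P j → IsMaximum P k → j ≡ k
IsMaximum-unique (Pj , j-max) (Pk , k-max) = ℕ.≤-antisym (k-max Pj) (j-max Pk)

element : ∀ {n} (T : Subset n) → Fin ∣ T ∣ → Fin n
element (true  ∷ T) zero    = zero
element (true  ∷ T) (suc i) = suc (element T i)
element (false ∷ T) i       = suc (element T i)

element-∈ : ∀ {n} (T : Subset n) i → element T i ∈ T
element-∈ (true  ∷ T) zero    = here
element-∈ (true  ∷ T) (suc i) = there (element-∈ T i)
element-∈ (false ∷ T) i       = there (element-∈ T i)

element-injective : ∀ {n} (T : Subset n) {i j} → element T i ≡ element T j → i ≡ j
element-injective (true  ∷ T) {zero}  {zero}  eq = refl
element-injective (true  ∷ T) {suc i} {suc j} eq =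
  cong suc (element-injective T (suc-injective eq))
element-injective (false ∷ T) eq = element-injective T (suc-injective eq)

-- Picking one label for each element of `T` is an injection into `Fin k`. Labels are related to
-- elements by a relation, since an edge may carry several of them.
∣∣≤-byLabels : ∀ {n k} {T : Subset n} {R : Fin n → Fin k → Set} →
  (∀ {e} → e ∈ T → ∃ (R e)) →
  (∀ {e f l} → e ∈ T → f ∈ T → R e l → R f l → e ≡ f) →
  ∣ T ∣ ≤ k
∣∣≤-byLabels {T = T} {R} label label-injective = injective⇒≤ {f = proj₁ ∘ labelled} λ {i} {j} eq →
  element-injective T $ label-injective (element-∈ T i) (element-∈ T j)
    (proj₂ (labelled i)) (subst (R _) (sym eq) (proj₂ (labelled j)))
  where
  labelled : ∀ i → ∃ (R (element T i))
  labelled i = label (element-∈ T i)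

bijective? : ∀ {a b} (f : Fin a → Fin b) → Dec (Bijective _≡_ _≡_ f)
bijective? f =
  map′ (λ inj {x} {y} → inj x y) (λ inj x y → inj {x} {y})
    (all? λ x → all? λ y → (f x Fin.≟ f y) →-dec (x Fin.≟ y))
  ×-dec
  all? λ y → map′ (λ (x , fx≡y) → x , λ z≡x → trans (cong f z≡x) fx≡y)
                  (λ (x , fx≡y) → x , fx≡y refl)
                  (any? λ x → f x Fin.≟ y)

∃!? : ∀ {n} {P : Pred (Fin n) 0ℓ} → Decidable P → Dec (∃! _≡_ P)
∃!? P? = any? λ x → P? x ×-dec
  map′ (λ all {y} → all y) (λ all y → all {y}) (all? λ y → P? y →-dec (x Fin.≟ y))

-- Existence of the mim value of a cut.

module _ {n m} (G : Graph n m) where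
  open Multigraph G

  isInducedMatching? : ∀ F S → Dec (IsInducedMatching G F S)
  isInducedMatching? F S = map′ (λ all {v} → all v) (λ all v → all {v}) $
    all? λ v → (v ∈? S) →-dec
      ∃!? λ e → (e ∈? inside G F S) ×-dec
        ((v Fin.≟ proj₁ (ends e)) ⊎-dec (v Fin.≟ proj₂ (ends e)))

  abstract
    mim : ∀ X → ∃ (IsMim G X)
    mim X = let F = between G X (∁ X) in maximum
      (λ k → anySubset? λ S → isInducedMatching? F S ×-dec (∣ inside G F S ∣ ℕ.≟ k))
      -- The empty set is an induced matching, so some value is attained.
      (_ , ⊥ , (λ v∈⊥ → contradiction v∈⊥ ∉⊥) , refl)
      m λ { (S , _ , refl) → ∣p∣≤n (inside G F S) }

-- Finite enumeration of tree nodes and branch trees.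

nodes : ∀ {N L : Set} (t : Tree N L) → List (Node t)
nodes (leaf x)     = here ∷ []
nodes (node l x r) = here ∷ List.map left (nodes l) ++ List.map right (nodes r)

∈-nodes : ∀ {N L : Set} {t : Tree N L} (w : Node t) → w ∈ˡ nodes t
∈-nodes {t = leaf x}     here      = here refl
∈-nodes {t = node l x r} here      = here refl
∈-nodes {t = node l x r} (left w)  = there (∈-++⁺ˡ (∈-map⁺ left (∈-nodes w)))
∈-nodes {t = node l x r} (right w) = there (∈-++⁺ʳ (List.map left (nodes l)) (∈-map⁺ right (∈-nodes w)))

argmaxNode : ∀ {N L : Set} {t : Tree N L} (f : Node t → ℕ) → ∃[ w ] (∀ w′ → f w′ ≤ f w)
argmaxNode {t = t} f = argmax f here (nodes t) ,
  λ w → All.lookup (f[xs]≤f[argmax] {f = f} here (nodes t)) (∈-nodes w)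

length-toDiffList : ∀ {N L : Set} (t : Tree N L) xs →
  length (Leaves.toDiffList t xs) ≡ #leaves t + length xs
length-toDiffList (leaf x)     xs = refl
length-toDiffList (node l x r) xs = begin
  length (Leaves.toDiffList l (Leaves.toDiffList r xs)) ≡⟨ length-toDiffList l _ ⟩
  #leaves l + length (Leaves.toDiffList r xs)           ≡⟨ cong (#leaves l +_) (length-toDiffList r xs) ⟩
  #leaves l + (#leaves r + length xs)                   ≡⟨ ℕ.+-assoc (#leaves l) _ _ ⟨
  #leaves l + #leaves r + length xs                     ∎
  where open ≡-Reasoning

1≤#leaves : ∀ {N L : Set} (t : Tree N L) → 1 ≤ #leaves t
1≤#leaves (leaf x)     = ℕ.≤-refl
1≤#leaves (node l x r) = ℕ.≤-trans (1≤#leaves l) (ℕ.m≤m+n _ _)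

module _ (n : ℕ) where

  treesOfDepth≤ : ℕ → List (Tree ⊤ (Fin n))
  treesOfDepth≤ zero    = []
  treesOfDepth≤ (suc d) = List.map leaf (allFin n) ++
    cartesianProductWith (λ l r → node l tt r) (treesOfDepth≤ d) (treesOfDepth≤ d)

  -- Each subtree of an inner node misses at least the one leaf that its sibling must have, so the
  -- leaf count drops at every level and bounds the depth, a single leaf having depth 1.
  ∈-treesOfDepth≤ : ∀ d t → #leaves t ≤ d → t ∈ˡ treesOfDepth≤ d
  ∈-treesOfDepth≤ zero    t            ≤d = contradiction (ℕ.≤-trans (1≤#leaves t) ≤d) λ ()
  ∈-treesOfDepth≤ (suc d) (leaf x)     ≤d = ∈-++⁺ˡ (∈-map⁺ leaf (∈-allFin x))
  ∈-treesOfDepth≤ (suc d) (node l _ r) ≤d = ∈-++⁺ʳ (List.map leaf (allFin n)) $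
    ∈-cartesianProductWith⁺ (λ l r → node l tt r)
      (∈-treesOfDepth≤ d l (ℕ.≤-pred (ℕ.≤-trans (ℕ.m<m+n (#leaves l) (1≤#leaves r)) ≤d)))
      (∈-treesOfDepth≤ d r (ℕ.≤-pred (ℕ.≤-trans (ℕ.m<n+m (#leaves r) (1≤#leaves l)) ≤d)))

  IsBranchTree : Tree ⊤ (Fin n) → Set
  IsBranchTree t = Bijective _≡_ _≡_ (List.lookup (Leaves.toList t))

  branchTrees : List (Tree ⊤ (Fin n))
  branchTrees = filter (λ t → bijective? (List.lookup (Leaves.toList t))) (treesOfDepth≤ n)

  branchTrees-bijective : All IsBranchTree branchTrees
  branchTrees-bijective =
    all-filter (λ t → bijective? (List.lookup (Leaves.toList t))) (treesOfDepth≤ n)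

  -- Injectivity of the leaf labelling leaves room for at most `n` leaves, which places the tree in
  -- the finite list that was filtered.
  ∈-branchTrees : ∀ D → BranchDecomposition.tree D ∈ˡ branchTrees
  ∈-branchTrees D = ∈-filter⁺ _ (∈-treesOfDepth≤ n tree #leaves≤n) bijective
    where
    open BranchDecomposition D
    open ℕ.≤-Reasoning
    #leaves≤n : #leaves tree ≤ n
    #leaves≤n = begin
      #leaves tree                ≡⟨ ℕ.+-identityʳ _ ⟨
      #leaves tree + 0            ≡⟨ length-toDiffList tree [] ⟨
      length (Leaves.toList tree) ≤⟨ injective⇒≤ (proj₁ bijective) ⟩
      n                           ∎

-- Existence of the mim-width.

module _ {n m} (G : Graph n m) where

  below : (t : Tree ⊤ (Fin n)) → Node t → Subset n
  below t w = ⋃ (List.map ⁅_⁆ (Leaves.toList (subtree w)))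

  mimBelow : (t : Tree ⊤ (Fin n)) → Node t → ℕ
  mimBelow t w = proj₁ (mim G (below t w))

  widest : (t : Tree ⊤ (Fin n)) → ∃[ w ] (∀ w′ → mimBelow t w′ ≤ mimBelow t w)
  widest t = argmaxNode (mimBelow t)

  width : Tree ⊤ (Fin n) → ℕ
  width t = mimBelow t (proj₁ (widest t))

  width-isWidth : ∀ D → IsWidth G D (width (BranchDecomposition.tree D))
  width-isWidth D = (proj₁ (widest tree) , proj₂ (mim G (below tree (proj₁ (widest tree))))) ,
    λ { (w , isMim) → ℕ.≤-trans
          (ℕ.≤-reflexive (IsMaximum-unique isMim (proj₂ (mim G (below tree w)))))
          (proj₂ (widest tree) w) }
    where open BranchDecomposition D

  CutMims≤ : ℕ → BranchDecomposition n → Set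
  CutMims≤ b D = ∀ w k → IsMim G (BranchDecomposition.verticesBelow D w) k → k ≤ b

  -- The minimum is found by searching the finite list of branch trees. The tree of `D` is the
  -- default of `argmin`, so the optimum is no wider than `D`, whose width is attained at a node and
  -- hence at most `b`.
  mimWidth≤ : ∀ {b} D → CutMims≤ b D → ∃[ k ] (IsMimWidth G k × k ≤ b)
  mimWidth≤ D bound = width best ,
    ( (bestDecomposition , width-isWidth bestDecomposition)
    , λ { (D′ , isWidth) → subst (width best ≤_)
          (IsMaximum-unique {P = λ k → ∃[ w ] IsMim G (BranchDecomposition.verticesBelow D′ w) k}
            (width-isWidth D′) isWidth)
          (All.lookup (f[argmin]≤f[xs] {f = width} t₀ (branchTrees n)) (∈-branchTrees n D′)) } ) ,
    ℕ.≤-trans (f[argmin]≤f[⊤] {f = width} t₀ (branchTrees n))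
      (bound (proj₁ (widest t₀)) _ (proj₂ (mim G (below t₀ (proj₁ (widest t₀))))))
    where
    open BranchDecomposition D renaming (tree to t₀)
    best = argmin width t₀ (branchTrees n)
    bestDecomposition : BranchDecomposition n
    bestDecomposition = record
      { tree = best ; bijective = argmin-all width bijective (branchTrees-bijective n) }

-- Cut edges and induced matchings.

∈-tabulate⁺ : ∀ {n} (f : Fin n → _) {i} → f i ≡ true → i ∈ tabulate f
∈-tabulate⁺ f {i} eq = lookup⇒[]= i _ (trans (lookup∘tabulate f i) eq)

∈-tabulate⁻ : ∀ {n} (f : Fin n → _) {i} → i ∈ tabulate f → f i ≡ true
∈-tabulate⁻ f {i} i∈ = trans (sym (lookup∘tabulate f i)) ([]=⇒lookup i∈)

module _ {p q} (G : Graph p q) where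
  open Multigraph G

  private variable
    X S : Subset p
    F : Subset q
    e : Fin q
    u v : Fin p

  ∈-between⁻ : e ∈ between G X (∁ X) → ∃₂ λ x y → Joins e x y × x ∉ X × y ∈ X
  ∈-between⁻ {e} {X} e∈
    with lookup X (proj₁ (ends e)) in eqᵘ | lookup (∁ X) (proj₂ (ends e)) in eqᵛ
       | lookup (∁ X) (proj₁ (ends e)) in eqᵘ′ | lookup X (proj₂ (ends e)) in eqᵛ′
       | ∈-tabulate⁻ _ e∈
  ... | true  | true  | _    | _    | _ =
    _ , _ , inj₂ refl , x∈∁p⇒x∉p (lookup⇒[]= _ _ eqᵛ) , lookup⇒[]= _ _ eqᵘ
  ... | true  | false | true | true | _ =
    _ , _ , inj₁ refl , x∈∁p⇒x∉p (lookup⇒[]= _ _ eqᵘ′) , lookup⇒[]= _ _ eqᵛ′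
  ... | false | _     | true | true | _ =
    _ , _ , inj₁ refl , x∈∁p⇒x∉p (lookup⇒[]= _ _ eqᵘ′) , lookup⇒[]= _ _ eqᵛ′

  ∈-between⁺ : Joins e u v → u ∉ X → v ∈ X → e ∈ between G X (∁ X)
  ∈-between⁺ {e} {u} {v} {X} e-joins u∉X v∈X = ∈-tabulate⁺ _ (crosses e-joins)
    where
    crosses : ∀ {w} → w ≡ (u , v) ⊎ w ≡ (v , u) →
      (lookup X (proj₁ w) ∧ lookup (∁ X) (proj₂ w)) ∨ (lookup (∁ X) (proj₁ w) ∧ lookup X (proj₂ w)) ≡ true
    crosses (inj₁ refl) rewrite []=⇒lookup v∈X | []=⇒lookup (x∉p⇒x∈∁p u∉X) = ∨-zeroʳ _
    crosses (inj₂ refl) rewrite []=⇒lookup v∈X | []=⇒lookup (x∉p⇒x∈∁p u∉X) = refl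

  ∈-inside⁻ : Joins e u v → e ∈ inside G F S → u ∈ S × v ∈ S
  ∈-inside⁻ {e} {u} {v} {F} {S} e-joins e∈
    with lookup S (proj₁ (ends e)) in eqᵘ | lookup S (proj₂ (ends e)) in eqᵛ
       | ∈-tabulate⁻ _ (proj₂ (x∈p∩q⁻ F _ e∈)) | e-joins
  ... | true | true | _ | inj₁ refl = lookup⇒[]= _ _ eqᵘ , lookup⇒[]= _ _ eqᵛ
  ... | true | true | _ | inj₂ refl = lookup⇒[]= _ _ eqᵛ , lookup⇒[]= _ _ eqᵘ

  ∈-inside⁺ : Joins e u v → e ∈ F → u ∈ S → v ∈ S → e ∈ inside G F S
  ∈-inside⁺ {e} {u} {v} {F} {S} e-joins e∈F u∈S v∈S =
    x∈p∩q⁺ (e∈F , ∈-tabulate⁺ _ (contained e-joins))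
    where
    contained : ∀ {w} → w ≡ (u , v) ⊎ w ≡ (v , u) →
      lookup S (proj₁ w) ∧ lookup S (proj₂ w) ≡ true
    contained (inj₁ refl) rewrite []=⇒lookup u∈S | []=⇒lookup v∈S = refl
    contained (inj₂ refl) rewrite []=⇒lookup u∈S | []=⇒lookup v∈S = refl

  incidentˡ : Joins e u v → Incident u e
  incidentˡ (inj₁ eq) = inj₁ (sym (cong proj₁ eq))
  incidentˡ (inj₂ eq) = inj₂ (sym (cong proj₂ eq))

  incidentʳ : Joins e u v → Incident v e
  incidentʳ = incidentˡ ∘ swap

  module _ {A : Set} {M : Fin p → Pred A 0ℓ} (isIntersectionGraph : IsIntersectionGraph G M) where
    open IsIntersectionGraph isIntersectionGraph

    -- As `M x` meets `M y′`, some edge `g` joins `x` to `y′`, and it lies in the induced subgraph.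
    -- It shares `x` with `e` and `y′` with `f`, and a vertex of `S` has only one incident edge
    -- there, so `e`, `g` and `f` coincide.
    crossEdge-unique : ∀ {X S e f x y x′ y′} (let T = inside G (between G X (∁ X)) S) →
      IsInducedMatching G (between G X (∁ X)) S → e ∈ T → f ∈ T →
      Joins e x y → Joins f x′ y′ → x ∉ X → y′ ∈ X → M x ≬ M y′ → e ≡ f
    crossEdge-unique {X} {S} {x = x} {y′ = y′} matching e∈ f∈ e-joins f-joins x∉X y′∈X meets
      with Equivalence.from (adjacent x y′) ((λ { refl → x∉X y′∈X }) , meets)
    ... | g , g-joins = trans (same x∈S (e∈ , incidentˡ e-joins) (g∈ , incidentˡ g-joins))
                              (same y′∈S (g∈ , incidentʳ g-joins) (f∈ , incidentʳ f-joins))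
      where
      T = inside G (between G X (∁ X)) S
      x∈S = proj₁ (∈-inside⁻ e-joins e∈)
      y′∈S = proj₂ (∈-inside⁻ f-joins f∈)
      g∈ : g ∈ T
      g∈ = ∈-inside⁺ g-joins (∈-between⁺ g-joins x∉X y′∈X) x∈S y′∈S
      same : ∀ {v a b} → v ∈ S → a ∈ T × Incident v a → b ∈ T × Incident v b → a ≡ b
      same v∈S a-inc b-inc =
        let (_ , _ , unique) = matching v∈S in trans (sym (unique a-inc)) (unique b-inc)

    -- Two matching edges with a common label have an edge of the cut running between them, and by
    -- `crossEdge-unique` they are then equal. So the labels count the matching.
    mim≤-byLabels : ∀ {X j k} {R : Fin p → Fin p → Fin k → Set} →
      (∀ {x y} → x ∉ X → y ∈ X → M x ≬ M y → ∃ (R x y)) →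
      (∀ {x y x′ y′ l} → x ∉ X → y ∈ X → x′ ∉ X → y′ ∈ X → R x y l → R x′ y′ l →
        M x ≬ M y′ ⊎ M x′ ≬ M y) →
      IsMim G X j → j ≤ k
    mim≤-byLabels {X} {k = k} {R} label conflict ((S , matching , refl) , _) =
      ∣∣≤-byLabels {R = Labelled} labelled labelled-injective
      where
      T = inside G (between G X (∁ X)) S
      Labelled : Fin q → Fin k → Set
      Labelled e l = ∃₂ λ x y → Joins e x y × x ∉ X × y ∈ X × R x y l
      labelled : ∀ {e} → e ∈ T → ∃ (Labelled e)
      labelled e∈ with ∈-between⁻ (proj₁ (x∈p∩q⁻ _ _ e∈))
      ... | x , y , e-joins , x∉X , y∈X
        with label x∉X y∈X (proj₂ (Equivalence.to (adjacent x y) (_ , e-joins)))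
      ... | l , Rxyl = l , x , y , e-joins , x∉X , y∈X , Rxyl
      labelled-injective : ∀ {e f l} → e ∈ T → f ∈ T → Labelled e l → Labelled f l → e ≡ f
      labelled-injective e∈ f∈
        (x , y , e-joins , x∉X , y∈X , Rxyl) (x′ , y′ , f-joins , x′∉X , y′∈X , Rx′y′l)
        with conflict x∉X y∈X x′∉X y′∈X Rxyl Rx′y′l
      ... | inj₁ meets = crossEdge-unique matching e∈ f∈ e-joins f-joins x∉X y′∈X meets
      ... | inj₂ meets = sym (crossEdge-unique matching f∈ e∈ f-joins e-joins x′∉X y∈X meets)

-- Walks in the subdivision and the stretches they fill.

module _ {a} {A : Set a} where

  lookup-∷ʳ-inject₁ : ∀ {n} (xs : Vec A n) x i → lookup (xs ∷ʳ x) (inject₁ i) ≡ lookup xs i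
  lookup-∷ʳ-inject₁ (y ∷ xs) x zero    = refl
  lookup-∷ʳ-inject₁ (y ∷ xs) x (suc i) = lookup-∷ʳ-inject₁ xs x i

  lookup-∷ʳ-fromℕ : ∀ {n} (xs : Vec A n) x → lookup (xs ∷ʳ x) (fromℕ n) ≡ x
  lookup-∷ʳ-fromℕ []       x = refl
  lookup-∷ʳ-fromℕ (y ∷ xs) x = lookup-∷ʳ-fromℕ xs x

module _ {n m} (H : Graph n m) (ℓ : Fin m → ℕ) where
  open Multigraph (subdivide H ℓ)

  V′ : Set
  V′ = SubdivVertex H ℓ

  Position : Fin m → Set
  Position e = Fin (suc (suc (ℓ e)))

  at : ∀ e → Position e → V′
  at e = lookup (path H ℓ e)

  at-inner : ∀ e (j : Fin (ℓ e)) → at e (suc (inject₁ j)) ≡ inj₂ (e , j)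
  at-inner e j = trans (lookup-∷ʳ-inject₁ (tabulate _) _ j) (lookup∘tabulate _ j)

  at-top : ∀ e → at e (suc (fromℕ (ℓ e))) ≡ inj₁ (proj₂ (Multigraph.ends H e))
  at-top e = lookup-∷ʳ-fromℕ (tabulate λ i → inj₂ (e , i)) _

  at-inner-unique : ∀ {e j e′} i′ → at e′ i′ ≡ inj₂ (e , j) →
    (e′ , i′) ≡ (Σ (Fin m) Position ∋ (e , suc (inject₁ j)))
  at-inner-unique {e′ = e′} (suc i′) eq with view i′
  ... | ‵fromℕ = contradiction (trans (sym eq) (at-top e′)) λ ()
  ... | ‵inject₁ j′ with refl ← trans (sym (at-inner e′ j′)) eq = refl

  module _ (start : Fin m → ℕ) where

    -- P contains the stretch of e by which a walk inside P arrives at position i: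
    -- forwards from start e (zero), or backwards from the last position (suc zero).
    Fills : Pred V′ 0ℓ → Fin 2 → ∀ e → Position e → Set
    Fills P zero       e i = ∀ {k} → toℕ k ≤ toℕ i → start e ≤ toℕ k → at e k ∈ᴾ P
    Fills P (suc zero) e i = ∀ {k} → toℕ i ≤ toℕ k → at e k ∈ᴾ P

    -- The invariant carried along a walk inside `P`; `e` is the edge of H being traversed and `d`
    -- the direction of the stretch.
    Reached : Pred V′ 0ℓ → V′ → Set
    Reached P u = ∃₂ λ d e → ∃[ i ] (u ≡ at e i × Fills P d e i)

    module _ (P : Pred V′ 0ℓ) {e : Fin m} (i : Fin (suc (ℓ e)))
             (u∈P : at e (inject₁ i) ∈ᴾ P) (v∈P : at e (suc i) ∈ᴾ P) where

      -- A forward stretch gains the new vertex; a backward one loses its end.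
      fills-suc : ∀ d → Fills P d e (inject₁ i) → Fills P d e (suc i)
      fills-suc zero fills {k} k≤ start≤ with ℕ.m≤n⇒m<n∨m≡n k≤
      ... | inj₁ (s≤s k≤i) = fills (subst (toℕ k ≤_) (sym (toℕ-inject₁ i)) k≤i) start≤
      ... | inj₂ k≡ = subst (λ k → at e k ∈ᴾ P) (toℕ-injective (sym k≡)) v∈P
      fills-suc (suc zero) fills k≥ =
        fills (ℕ.≤-trans (ℕ.≤-reflexive (toℕ-inject₁ i)) (ℕ.<⇒≤ k≥))

      fills-pred : ∀ d → Fills P d e (suc i) → Fills P d e (inject₁ i)
      fills-pred zero fills k≤ start≤ =
        fills (ℕ.m≤n⇒m≤1+n (ℕ.≤-trans k≤ (ℕ.≤-reflexive (toℕ-inject₁ i)))) start≤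
      fills-pred (suc zero) fills {k} k≥ with ℕ.m≤n⇒m<n∨m≡n k≥
      ... | inj₁ i<k = fills (subst (_< toℕ k) (toℕ-inject₁ i) i<k)
      ... | inj₂ i≡ = subst (λ k → at e k ∈ᴾ P) (toℕ-injective i≡) u∈P

    -- The invariant could name any position of the vertex, but an inner vertex has only one, so the
    -- stretch found is on `e` itself.
    reached-inner : ∀ {P e j} → Reached P (at e (suc (inject₁ j))) →
      ∃[ d ] Fills P d e (suc (inject₁ j))
    reached-inner {e = e} {j} (d , e′ , i′ , eq , fills)
      with refl ← at-inner-unique i′ (trans (sym eq) (at-inner e j)) = d , fills

    -- A step away from an end of e makes u itself a stretch of e, and at an inner
    -- vertex there is no other edge, so the stretch there extends or shrinks by one.
    reached-step : ∀ {P u v} → Adjacent u v → u ∈ᴾ P → v ∈ᴾ P → Reached P u → Reached P v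
    reached-step {P} ((e , zero) , inj₁ refl) u∈P v∈P _ =
      zero , e , suc zero , refl , fills-suc P zero u∈P v∈P zero λ { {zero} _ _ → u∈P }
    reached-step {P} ((e , suc j) , inj₁ refl) u∈P v∈P reached =
      let d , fills = reached-inner {P} reached in
      d , e , suc (suc j) , refl , fills-suc P (suc j) u∈P v∈P d fills
    reached-step {P} ((e , i) , inj₂ refl) u∈P v∈P reached with view i
    ... | ‵fromℕ = suc zero , e , inject₁ (fromℕ _) , refl ,
      fills-pred P (fromℕ _) v∈P u∈P (suc zero)
        λ {k} top≤k → subst (λ k → at e k ∈ᴾ P) (Fin.≤-antisym top≤k (≤fromℕ k)) u∈P
    ... | ‵inject₁ j =
      let d , fills = reached-inner {P} reached in
      d , e , inject₁ (inject₁ j) , refl , fills-pred P (inject₁ j) v∈P u∈P d fills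

    reached-walk : ∀ {P u v} → Star (λ x y → Adjacent x y × x ∈ᴾ P × y ∈ᴾ P) u v →
      Reached P u → Reached P v
    reached-walk     ε                          reached = reached
    reached-walk {P} ((adj , u∈P , v∈P) ◅ walk) reached =
      reached-walk {P} walk (reached-step adj u∈P v∈P reached)

    -- The threshold itself counts for both `Early` and `Late`, because vertices of G with the same
    -- first position may be separated by the cut.
    Early : Pred V′ 0ℓ → Set
    Early P = ∃₂ λ e i → at e i ∈ᴾ P × toℕ i ≤ start e

    Late : Pred V′ 0ℓ → Set
    Late Q = ∀ {e i} → at e i ∈ᴾ Q → start e ≤ toℕ i

    -- The walk begins with a trivial forward stretch: since `i` is at most `start e`, no position
    -- other than `i` can lie between the two.
    early⇒reached : ∀ {P v} → InducesConnected P → Early P → v ∈ᴾ P → Reached P v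
    early⇒reached {P} conn (e , i , u∈P , i≤start) v∈P = reached-walk {P} (conn u∈P v∈P)
      (zero , e , i , refl , λ k≤i start≤k →
        subst (λ k → at e k ∈ᴾ P) (toℕ-injective (ℕ.≤-antisym (ℕ.≤-trans i≤start start≤k) k≤i)) u∈P)

    Label : Pred V′ 0ℓ → Pred V′ 0ℓ → Fin 2 → Fin m → Set
    Label P Q d e = ∃[ i ] (at e i ∈ᴾ Q × Fills P d e i)

    -- Two stretches of `e` in the same direction are nested. Going forwards, lateness puts the end
    -- of the shorter one past `start e`, hence inside the longer one; going backwards, the stretch
    -- from the smaller position reaches over the other.
    label-conflict : ∀ {P Q P′ Q′} → Late Q → Late Q′ → ∀ d e →
      Label P Q d e → Label P′ Q′ d e → P ≬ Q′ ⊎ P′ ≬ Q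
    label-conflict late late′ d e (i , i∈Q , fills) (i′ , i′∈Q′ , fills′)
      with ℕ.≤-total (toℕ i) (toℕ i′) | d
    ... | inj₁ i≤i′ | zero     = inj₂ (_ , fills′ i≤i′ (late i∈Q) , i∈Q)
    ... | inj₂ i′≤i | zero     = inj₁ (_ , fills i′≤i (late′ i′∈Q′) , i′∈Q′)
    ... | inj₁ i≤i′ | suc zero = inj₁ (_ , fills i≤i′ , i′∈Q′)
    ... | inj₂ i′≤i | suc zero = inj₂ (_ , fills′ i′≤i , i∈Q)

    -- The `2 * m` labels are the pairs of a direction and an edge of H, encoded by `combine`, whose
    -- injectivity recovers the pair.
    mim≤2‖H‖ : ∀ {p q} {G : Graph p q} {M : Fin p → Pred V′ 0ℓ} {X : Subset p} →
      IsIntersectionGraph G M → (∀ v → InducesConnected (M v)) →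
      (∀ {x} → x ∉ X → Early (M x)) → (∀ {y} → y ∈ X → Late (M y)) →
      ∀ {k} → IsMim G X k → k ≤ 2 * m
    mim≤2‖H‖ {p} {G = G} {M} {X} isIG conn early late = mim≤-byLabels G isIG {R = R} label conflict
      where
      R : Fin p → Fin p → Fin (2 * m) → Set
      R x y l = ∃₂ λ d e → combine d e ≡ l × Label (M x) (M y) d e
      label : ∀ {x y} → x ∉ X → y ∈ X → M x ≬ M y → ∃ (R x y)
      label {x} x∉X y∈X (z , z∈x , z∈y) with early⇒reached (conn x) (early x∉X) z∈x
      ... | d , e , i , refl , fills = combine d e , d , e , refl , i , z∈y , fills
      conflict : ∀ {x y x′ y′ l} → x ∉ X → y ∈ X → x′ ∉ X → y′ ∈ X → R x y l → R x′ y′ l →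
        M x ≬ M y′ ⊎ M x′ ≬ M y
      conflict _ y∈X _ y′∈X (d , e , refl , lab) (d′ , e′ , eq , lab′)
        with refl , refl ← combine-injective d′ e′ d e eq =
        label-conflict {P = M _} {P′ = M _} (late y∈X) (late y′∈X) d e lab lab′

-- Lexicographically first positions.

first? : ∀ {n} {P : Pred (Fin n) 0ℓ} → Decidable P →
  (∃[ i ] (P i × ∀ {j} → P j → toℕ i ≤ toℕ j)) ⊎ (∀ i → ¬ P i)
first? {zero}  P? = inj₂ λ ()
first? {suc n} P? with P? zero | first? (P? ∘ suc)
... | yes P₀ | _                  = inj₁ (zero , P₀ , λ _ → z≤n)
... | no ¬P₀ | inj₁ (i , Pi , i≤) = inj₁ (suc i , Pi , λ
  { {zero} P₀ → contradiction P₀ ¬P₀ ; {suc j} Pj → s≤s (i≤ Pj) })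
... | no ¬P₀ | inj₂ ∄P            = inj₂ λ { zero → ¬P₀ ; (suc i) → ∄P i }

lexOrder : DecTotalOrder _ _ _
lexOrder = ×-decTotalOrder ℕ.≤-decTotalOrder ℕ.≤-decTotalOrder

module Lex = DecTotalOrder lexOrder

proj₁-mono : ∀ {a b} → a Lex.≤ b → proj₁ a ≤ proj₁ b
proj₁-mono (inj₁ (≤ , _)) = ≤
proj₁-mono (inj₂ (≡ , _)) = ℕ.≤-reflexive ≡

firstLex? : ∀ {m} {s : Fin m → ℕ} {P : ∀ e → Pred (Fin (s e)) 0ℓ} → (∀ e → Decidable (P e)) →
  (∃₂ λ e i → P e i × ∀ e′ i′ → P e′ i′ → (toℕ e , toℕ i) Lex.≤ (toℕ e′ , toℕ i′)) ⊎
  (∀ e i → ¬ P e i)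
firstLex? P? with first? (λ e → any? (P? e))
... | inj₂ ∄P = inj₂ λ e i Pei → ∄P e (i , Pei)
... | inj₁ (e , ∃i , e≤) with first? (P? e)
...   | inj₂ ∄i = contradiction (proj₂ ∃i) (∄i _)
...   | inj₁ (i , Pei , i≤) = inj₁ (e , i , Pei , minimal)
  where
  minimal : ∀ e′ i′ → _ → (toℕ e , toℕ i) Lex.≤ (toℕ e′ , toℕ i′)
  minimal e′ i′ Pe′i′ with e Fin.≟ e′
  ... | yes refl = inj₂ (refl , i≤ Pe′i′)
  ... | no e≢e′  = inj₁ (e≤ (i′ , Pe′i′) , e≢e′ ∘ toℕ-injective)

-- Caterpillars and their cuts.

-- The two kinds of cut of a caterpillar with leaf order xs.  In the second, below
-- is the part of xs from y on; only what it says about the order is recorded.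
data CombCut {A : Set} (_∼_ : A → A → Set) (xs below : List A) : Set where
  single : ∀ y → below ≡ y ∷ [] → CombCut _∼_ xs below
  suffix : ∀ y → y ∈ˡ xs → (∀ {z} → z ∈ˡ xs → z ∈ˡ below ⊎ z ∼ y) →
           (∀ {z} → z ∈ˡ below → y ∼ z) → CombCut _∼_ xs below

module _ {A : Set} where

  comb : A → List A → Tree ⊤ A
  comb x []       = leaf x
  comb x (y ∷ ys) = node (leaf x) tt (comb y ys)

  toList-comb : ∀ x xs → Leaves.toList (comb x xs) ≡ x ∷ xs
  toList-comb x []       = refl
  toList-comb x (y ∷ ys) = cong (x ∷_) (toList-comb y ys)

  combCut-root : ∀ {_∼_ : A → A → Set} → Reflexive _∼_ → ∀ x xs → AllPairs _∼_ (x ∷ xs) →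
    CombCut _∼_ (x ∷ xs) (Leaves.toList (comb x xs))
  combCut-root ∼-refl x xs (x∼ ∷ _) = suffix x (here refl)
    (inj₁ ∘ subst (_ ∈ˡ_) (sym (toList-comb x xs)))
    (All.lookup (∼-refl ∷ x∼) ∘ subst (_ ∈ˡ_) (toList-comb x xs))

  combCut : ∀ {_∼_ : A → A → Set} → Reflexive _∼_ → ∀ x xs → AllPairs _∼_ (x ∷ xs) →
    (w : Node (comb x xs)) → CombCut _∼_ (x ∷ xs) (Leaves.toList (subtree w))
  combCut ∼-refl x []       sorted        here = combCut-root ∼-refl x [] sorted
  combCut ∼-refl x (y ∷ ys) sorted        here = combCut-root ∼-refl x (y ∷ ys) sorted
  combCut ∼-refl x (y ∷ ys) (x∼ ∷ sorted) (left here) = single x refl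
  combCut ∼-refl x (y ∷ ys) (x∼ ∷ sorted) (right w) with combCut ∼-refl y ys sorted w
  ... | single z eq            = single z eq
  ... | suffix z z∈ above below = suffix z (there z∈)
    -- The leaf `x` split off at this level precedes all of the remaining list, in particular `z`.
    (λ { (here refl) → inj₂ (All.lookup x∼ z∈) ; (there z′∈) → above z′∈ }) below

  lookup-injective : {xs : List A} → Unique xs → Injective _≡_ _≡_ (List.lookup xs)
  lookup-injective {x ∷ xs} (x∉ ∷ uniq) {zero}  {zero}  eq = refl
  lookup-injective {x ∷ xs} (x∉ ∷ uniq) {zero}  {suc j} eq =
    contradiction eq (All.lookup x∉ (∈-lookup j))
  lookup-injective {x ∷ xs} (x∉ ∷ uniq) {suc i} {zero}  eq =
    contradiction (sym eq) (All.lookup x∉ (∈-lookup i))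
  lookup-injective {x ∷ xs} (x∉ ∷ uniq) {suc i} {suc j} eq = cong suc (lookup-injective uniq eq)

  lookup-bijective : {xs : List A} → Unique xs → (∀ x → x ∈ˡ xs) →
    Bijective _≡_ _≡_ (List.lookup xs)
  lookup-bijective uniq ∈xs = lookup-injective uniq ,
    λ x → Any.index (∈xs x) , λ { refl → sym (lookup-index (∈xs x)) }

module _ {n : ℕ} where

  ∈-⋃⁺ : ∀ {x : Fin n} {xs} → x ∈ˡ xs → x ∈ ⋃ (List.map ⁅_⁆ xs)
  ∈-⋃⁺ (here refl) = x∈p∪q⁺ (inj₁ (x∈⁅x⁆ _))
  ∈-⋃⁺ (there x∈)  = x∈p∪q⁺ (inj₂ (∈-⋃⁺ x∈))

  ∈-⋃⁻ : ∀ {x : Fin n} xs → x ∈ ⋃ (List.map ⁅_⁆ xs) → x ∈ˡ xs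
  ∈-⋃⁻ []       x∈ = contradiction x∈ ∉⊥
  ∈-⋃⁻ (y ∷ ys) x∈ with x∈p∪q⁻ ⁅ y ⁆ _ x∈
  ... | inj₁ x∈y  = here (x∈⁅y⁆⇒x≡y _ x∈y)
  ... | inj₂ x∈ys = there (∈-⋃⁻ ys x∈ys)

  combDecomposition : ∀ x xs → Unique (x ∷ xs) → (∀ v → v ∈ˡ x ∷ xs) → BranchDecomposition n
  combDecomposition x xs uniq ∈xs = record
    { tree      = comb x xs
    ; bijective = subst (λ ys → Bijective _≡_ _≡_ (List.lookup ys)) (sym (toList-comb x xs))
                    (lookup-bijective uniq ∈xs)
    }

-- The cuts of an H-graph along the sorted order.

module _ {n m p q} {H : Graph n m} {G : Graph p q} (isGraphOver : G IsGraphOver H) where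
  open _IsGraphOver_ isGraphOver

  OnEdge : Fin p → Set
  OnEdge v = ∃₂ λ e i → at H ℓ e i ∈ᴾ M v ×
    ∀ e′ i′ → at H ℓ e′ i′ ∈ᴾ M v → (toℕ e , toℕ i) Lex.≤ (toℕ e′ , toℕ i′)

  Isolated : Fin p → Set
  Isolated v = ∃[ u ] (inj₁ u ∈ᴾ M v × ∀ e i → at H ℓ e i ∉ᴾ M v)

  abstract
    onEdge-or-isolated : ∀ v → OnEdge v ⊎ Isolated v
    onEdge-or-isolated v with firstLex? (λ e i → M? v (at H ℓ e i))
    ... | inj₁ onEdge = inj₁ onEdge
    ... | inj₂ ∄at with nonEmpty v
    ...   | inj₁ u       , u∈ = inj₂ (u , u∈ , ∄at)
    ...   | inj₂ (e , j) , u∈ = contradiction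
      (subst (M v) (sym (at-inner H ℓ e j)) u∈) (∄at e (suc (inject₁ j)))

  -- A vertex `w` on no path has no incident edge in the subdivision, so a walk from it cannot take
  -- a step.
  singleton : ∀ {v w z} → (∀ e i → at H ℓ e i ≢ w) → w ∈ᴾ M v → z ∈ᴾ M v → z ≡ w
  singleton {v} ≢w w∈ z∈ with connected v w∈ z∈
  ... | ε                               = refl
  ... | (((e , i) , inj₁ refl) , _) ◅ _ = contradiction refl (≢w e (inject₁ i))
  ... | (((e , i) , inj₂ refl) , _) ◅ _ = contradiction refl (≢w e (suc i))

  -- m + u places the isolated vertices of H after all edges.
  firstPosition : ∀ {v} → OnEdge v ⊎ Isolated v → ℕ × ℕ
  firstPosition (inj₁ (e , i , _)) = toℕ e , toℕ i
  firstPosition (inj₂ (u , _))     = m + toℕ u , 0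

  key : Fin p → ℕ × ℕ
  key v = firstPosition (onEdge-or-isolated v)

  -- The threshold on each edge for the cut at c; suc (ℓ e) is the last position on e.
  start : ℕ × ℕ → Fin m → ℕ
  start (a , b) e with ℕ.<-cmp (toℕ e) a
  ... | tri< _ _ _ = suc (ℓ e)
  ... | tri≈ _ _ _ = b
  ... | tri> _ _ _ = 0

  -- On edges before `a` the threshold is the last position, which bounds every `i`; on `a` the
  -- second coordinates decide; edges after `a` contradict the hypothesis.
  ≤-start : ∀ c e (i : Position H ℓ e) → (toℕ e , toℕ i) Lex.≤ c → toℕ i ≤ start c e
  ≤-start (a , b) e i ≤c with ℕ.<-cmp (toℕ e) a | ≤c
  ... | tri< _ _ _   | _              = ℕ.≤-pred (toℕ<n i)
  ... | tri≈ _ e≡a _ | inj₁ (_ , e≢a) = contradiction e≡a e≢a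
  ... | tri≈ _ _ _   | inj₂ (_ , i≤b) = i≤b
  ... | tri> _ _ a<e | _              = contradiction a<e (ℕ.≤⇒≯ (proj₁-mono ≤c))

  start-≤ : ∀ c e (i : Position H ℓ e) → c Lex.≤ (toℕ e , toℕ i) → start c e ≤ toℕ i
  start-≤ (a , b) e i c≤ with ℕ.<-cmp (toℕ e) a | c≤
  ... | tri> _ _ _   | _              = z≤n
  ... | tri≈ _ e≡a _ | inj₁ (_ , a≢e) = contradiction (sym e≡a) a≢e
  ... | tri≈ _ _ _   | inj₂ (_ , b≤i) = b≤i
  ... | tri< e<a _ _ | _              = contradiction e<a (ℕ.≤⇒≯ (proj₁-mono c≤))

  -- If `y₀` lies on an edge, its first position supplies the thresholds. If it sits at an isolated
  -- vertex `u₀`, all intersections across the cut take place at `u₀`, so any two cut edges conflict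
  -- and one label is enough.
  sorted-mim≤ : ∀ {X k} y₀ →
    (∀ {x} → x ∉ X → key x Lex.≤ key y₀) → (∀ {y} → y ∈ X → key y₀ Lex.≤ key y) →
    IsMim G X k → k ≤ 1 ⊔ 2 * m
  sorted-mim≤ {X} y₀ x≤ ≤y isMim with onEdge-or-isolated y₀
  ... | inj₁ (e₀ , i₀ , _) = ℕ.m≤n⇒m≤o⊔n 1 $
    mim≤2‖H‖ H ℓ (start (toℕ e₀ , toℕ i₀)) {G = G} {M} intersection connected early late isMim
    where
    early : ∀ {x} → x ∉ X → _
    early {x} x∉X with onEdge-or-isolated x | x≤ x∉X
    ... | inj₁ (e , i , at∈ , _) | ≤c = e , i , at∈ , ≤-start _ e i ≤c
    -- An isolated vertex has a first coordinate of at least `m`, beyond every edge index, so it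
    -- cannot precede `y₀`.
    ... | inj₂ (u , _)           | ≤c =
      contradiction (proj₁-mono ≤c) (ℕ.<⇒≱ (ℕ.≤-trans (toℕ<n e₀) (ℕ.m≤m+n m _)))
    late : ∀ {y} → y ∈ X → ∀ {e i} → at H ℓ e i ∈ᴾ M y → _
    late {y} y∈X {e} {i} at∈ with onEdge-or-isolated y | ≤y y∈X
    ... | inj₁ (_ , _ , _ , minimal) | c≤ = start-≤ _ e i (Lex.trans c≤ (minimal e i at∈))
    ... | inj₂ (_ , _ , ∄at)         | _  = contradiction at∈ (∄at e i)
  ... | inj₂ (u₀ , _) = ℕ.m≤n⇒m≤n⊔o (2 * m) $
    mim≤-byLabels G intersection {R = λ x y _ → inj₁ u₀ ∈ᴾ M x × inj₁ u₀ ∈ᴾ M y}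
      label (λ _ _ _ _ (u₀∈x , _) (_ , u₀∈y′) → inj₁ (_ , u₀∈x , u₀∈y′)) isMim
    where
    isolated : ∀ {y} → y ∈ X → Σ (Isolated y) λ (u , _) → toℕ u₀ ≤ toℕ u
    isolated {y} y∈X with onEdge-or-isolated y | ≤y y∈X
    ... | inj₁ (e , _) | c≤ =
      contradiction (proj₁-mono c≤) (ℕ.<⇒≱ (ℕ.≤-trans (toℕ<n e) (ℕ.m≤m+n m _)))
    ... | inj₂ iso     | c≤ = iso , ℕ.+-cancelˡ-≤ m _ _ (proj₁-mono c≤)
    label : ∀ {x y} → x ∉ X → y ∈ X → M x ≬ M y →
      ∃ λ (_ : Fin 1) → inj₁ u₀ ∈ᴾ M x × inj₁ u₀ ∈ᴾ M y
    label {x} {y} x∉X y∈X (z , z∈x , z∈y) with isolated y∈X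
    ... | (u , u∈y , ∄at) , u₀≤u with at≢u ← (λ e i eq → ∄at e i (subst (M y) (sym eq) u∈y))
      with refl ← singleton {y} at≢u u∈y z∈y
      with onEdge-or-isolated x | x≤ x∉X
    ... | inj₁ (e , i , at∈ , _) | _ = contradiction (singleton {x} at≢u z∈x at∈) (at≢u e i)
    -- Both sets consist of the one vertex `u`; `y` coming after `y₀` gives `u₀` at most `u`, and
    -- `x` coming before gives the converse.
    ... | inj₂ (u′ , u′∈x , _)   | ≤c
      with refl ← singleton {x} at≢u z∈x u′∈x
      with refl ← toℕ-injective (ℕ.≤-antisym u₀≤u (ℕ.+-cancelˡ-≤ m _ _ (proj₁-mono ≤c))) =
      zero , z∈x , z∈y

  keyOrder : DecTotalOrder _ _ _
  keyOrder = On.decTotalOrder lexOrder key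

  open Data.List.Sort keyOrder using (sort; sort-↭; sort-↗)

  combCut-mim≤ : ∀ {xs below k} → (∀ v → v ∈ˡ xs) →
    CombCut (λ u v → key u Lex.≤ key v) xs below →
    IsMim G (⋃ (List.map ⁅_⁆ below)) k → k ≤ 1 ⊔ 2 * m
  -- All cut edges share the end `y`, so a single label suffices.
  combCut-mim≤ ∈xs (single y refl) isMim = ℕ.m≤n⇒m≤n⊔o (2 * m) $
    mim≤-byLabels G intersection {R = λ x y′ _ → M x ≬ M y′ × y′ ≡ y}
      (λ _ y′∈ meets → zero {0} , meets , only (∈-⋃⁻ (y ∷ []) y′∈))
      (λ { _ _ _ _ (meets , refl) (_ , refl) → inj₁ meets }) isMim
    where
    only : ∀ {z} → z ∈ˡ y ∷ [] → z ≡ y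
    only (here eq) = eq
  combCut-mim≤ {below = below} ∈xs (suffix y _ above after) isMim = sorted-mim≤ y
    (λ {x} x∉ → [ (λ x∈ → contradiction (∈-⋃⁺ x∈) x∉) , id ]′ (above (∈xs x)))
    (after ∘ ∈-⋃⁻ below) isMim

  combOrder-mim≤ : .{{NonZero p}} → ∃ (CutMims≤ G (1 ⊔ 2 * m))
  combOrder-mim≤ = fromOrder (sort (allFin p))
    (Sorted⇒AllPairs (DecTotalOrder.totalOrder keyOrder) (sort-↗ (allFin p)))
    (Permutation.Unique-resp-↭ (setoid (Fin p)) (↭⇒↭ₛ (↭-sym (sort-↭ (allFin p)))) (allFin⁺ p))
    (λ v → ∈-resp-↭ (↭-sym (sort-↭ (allFin p))) (∈-allFin v))
    where
    fromOrder : .{{NonZero p}} → ∀ xs → AllPairs (λ u v → key u Lex.≤ key v) xs →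
      Unique xs → (∀ v → v ∈ˡ xs) → ∃ (CutMims≤ G (1 ⊔ 2 * m))
    fromOrder {{nz}} [] _ _ ∈xs = contradiction (∈xs (fromℕ< (>-nonZero⁻¹ p {{nz}}))) λ ()
    fromOrder (x ∷ xs) sorted uniq ∈xs = combDecomposition x xs uniq ∈xs ,
      λ w k isMim → combCut-mim≤ ∈xs (combCut Lex.refl x xs sorted w) isMim

corollary1 : ∀ {n m p q : ℕ} .{{_ : NonZero p}} (H : Graph n m) (G : Graph p q) → G IsGraphOver H →
    ∃[ k ] (IsMimWidth G k × k ≤ 1 ⊔ 2 * ‖ H ‖)
corollary1 H G isGraphOver = let D , bound = combOrder-mim≤ isGraphOver in mimWidth≤ G D bound
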